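{- Let $G=(V,E)$ be a locally finite, connected, simple, undirected graph. Fix $\kappa\in\mathbb{R}$ and two integers $d,\tau\ge 0$. Suppose that $G$ satisfies $\mathrm{CD}(\kappa,\infty)$, that every vertex of $G$ has exactly $d$ neighbors, and that any two adjacent vertices of $G$ have exactly $\tau$ common neighbors. Then: 1. $2\kappa\le 4+\tau$; 2. $\mathrm{CD}(\kappa,n)$ holds for $n:=4d/(4+\tau-2\kappa)$; 3. $\mathrm{CD}(\kappa,n')$ fails for any $n'<n$.
   Context: For a locally finite graph $G=(V,E)$, write $N_x=\{y\in V:\{x,y\}\in E\}$ for the set of neighbors of $x$. The Laplacian acts on $f\in\mathbb{R}^V$ by $\Delta f(x)=\sum_{y\in N_x}(f(y)-f(x))$. For $f,g\in\mathbb{R}^V$, set $\Gamma_0(f,g)=fg$ and, for $k\ge 1$, $$\Gamma_k(f,g)=\tfrac12\left(\Delta\Gamma_{k-1}(f,g)-\Gamma_{k-1}(f,\Delta g)-\Gamma_{k-1}(g,\Delta f)\right).$$ For $\kappa\in\mathbb{R}$ and $n\in(0,\infty]$, $G$ satisfies $\mathrm{CD}(\kappa,n)$ if for all $f\in\mathbb{R}^V$ and all $x\in V$, $$\Gamma_2(f,f)(x)\ge \kappa\,\Gamma_1(f,f)(x)+\frac{(\Delta f(x))^2}{n},$$ where the last term is $0$ when $n=\infty$. When $2\kappa=4+\tau$, the quantity $4d/(4+\tau-2\kappa)$ is read as $\infty$.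
   Formalization: The formal theorem assumes d ≥ 1 (and a nonempty graph): for d = 0 the graph is a single vertex, CD(κ,n) holds for every κ and n, so 2κ ≤ 4+τ can fail, and n = 4d/(4+τ−2κ) is not a valid dimension or conclusion 3 fails. -}

module Defs where

open import Data.Empty using (⊥)
open import Data.Integer using (+_)
open import Data.List using (List; length; map; foldr)
open import Data.List.Membership.Propositional using (_∈_)
open import Data.List.Relation.Unary.Unique.Propositional using (Unique)
open import Data.Nat as ℕ using (ℕ; zero; suc)
import Data.Nat.Properties as ℕₚ
open import Data.Product using (∃; ∃-syntax; _×_; _,_; proj₁; proj₂)
open import Data.Rational as ℚ using (ℚ; 0ℚ; 1ℚ; ½; ∣_∣)
import Data.Rational.Properties as ℚₚ
open import Data.Rational.Solver using (module +-*-Solver)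
open import Data.Unit using (⊤)
open import Function.Bundles using (_⇔_)
open import Relation.Binary.Construct.Closure.ReflexiveTransitive using (Star)
open import Relation.Binary.Definitions using (Symmetric; Irreflexive)
open import Relation.Binary.PropositionalEquality
  using (_≡_; refl; sym; trans; cong; cong₂; subst)
open import Relation.Nullary using (Dec; yes; no)

recip : (p : ℚ) → 0ℚ ℚ.< p → ℚ
recip p 0<p = (ℚ.1/ p) {{ℚₚ.pos⇒nonZero p {{ℚ.positive 0<p}}}}

recip-inverseˡ : ∀ p 0<p → recip p 0<p ℚ.* p ≡ 1ℚ
recip-inverseˡ p 0<p = ℚₚ.*-inverseˡ p {{ℚₚ.pos⇒nonZero p {{ℚ.positive 0<p}}}}

0<recip : ∀ p 0<p → 0ℚ ℚ.< recip p 0<p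
0<recip p 0<p = ℚₚ.positive⁻¹ _ {{ℚₚ.1/pos⇒pos p {{ℚ.positive 0<p}}}}

0<1 : 0ℚ ℚ.< 1ℚ
0<1 = ℚₚ.positive⁻¹ 1ℚ

0<+ : ∀ {p q} → 0ℚ ℚ.< p → 0ℚ ℚ.< q → 0ℚ ℚ.< p ℚ.+ q
0<+ {p} {q} 0<p 0<q =
  ℚₚ.positive⁻¹ _ {{ℚₚ.pos+pos⇒pos p {{ℚ.positive 0<p}} q {{ℚ.positive 0<q}}}}

0<* : ∀ {p q} → 0ℚ ℚ.< p → 0ℚ ℚ.< q → 0ℚ ℚ.< p ℚ.* q
0<* {p} {q} 0<p 0<q =
  ℚₚ.positive⁻¹ _ {{ℚₚ.pos*pos⇒pos p {{ℚ.positive 0<p}} q {{ℚ.positive 0<q}}}}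

*-mono-≤ : ∀ {a b c d} → 0ℚ ℚ.≤ a → 0ℚ ℚ.≤ d → a ℚ.≤ b → c ℚ.≤ d → a ℚ.* c ℚ.≤ b ℚ.* d
*-mono-≤ {a} {b} {c} {d} 0≤a 0≤d a≤b c≤d = ℚₚ.≤-trans
  (ℚₚ.*-monoˡ-≤-nonNeg a {{ℚ.nonNegative 0≤a}} c≤d)
  (ℚₚ.*-monoʳ-≤-nonNeg d {{ℚ.nonNegative 0≤d}} a≤b)

Cauchy : (ℕ → ℚ) → Set
Cauchy s = ∀ ε → 0ℚ ℚ.< ε →
  ∃[ N ] ∀ m n → N ℕ.≤ m → N ℕ.≤ n → ∣ s m ℚ.- s n ∣ ℚ.≤ ε

record ℝ : Set where
  constructor mkℝ
  field
    seq    : ℕ → ℚ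
    cauchy : Cauchy seq
open ℝ public

infix 4 _≤_ _<_

-- ℝ is not quotiented: two sequences represent the same real number when each
-- is ≤ the other, and both _≤_ and _<_ are invariant under this equivalence.
_≤_ : ℝ → ℝ → Set
x ≤ y = ∀ ε → 0ℚ ℚ.< ε → ∃[ N ] ∀ n → N ℕ.≤ n → seq x n ℚ.≤ seq y n ℚ.+ ε

_<_ : ℝ → ℝ → Set
x < y = ∃[ ε ] (0ℚ ℚ.< ε) × ∃[ N ] ∀ n → N ℕ.≤ n → seq x n ℚ.+ ε ℚ.≤ seq y n

fromℚ : ℚ → ℝ
fromℚ p = mkℝ (λ _ → p) λ ε 0<ε → 0 , λ _ _ _ _ →
  subst (λ t → ∣ t ∣ ℚ.≤ ε) (sym (ℚₚ.+-inverseʳ p)) (ℚₚ.<⇒≤ 0<ε)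

fromℕ : ℕ → ℝ
fromℕ n = fromℚ (+ n ℚ./ 1)

0ℝ : ℝ
0ℝ = fromℕ 0

½+½ : ∀ ε → ½ ℚ.* ε ℚ.+ ½ ℚ.* ε ≡ ε
½+½ ε = trans (sym (ℚₚ.*-distribʳ-+ ε ½ ½)) (ℚₚ.*-identityˡ ε)

+-cauchy : ∀ {s t} → Cauchy s → Cauchy t → Cauchy (λ n → s n ℚ.+ t n)
+-cauchy {s} {t} cs ct ε 0<ε =
  let 0<½ε   = 0<* {½} (ℚₚ.positive⁻¹ ½) 0<ε
      M , hM = cs (½ ℚ.* ε) 0<½ε
      N , hN = ct (½ ℚ.* ε) 0<½ε
  in M ℕ.⊔ N , λ m n m≥ n≥ → begin
    ∣ (s m ℚ.+ t m) ℚ.- (s n ℚ.+ t n) ∣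
      ≡⟨ cong ∣_∣ (rearrange (s m) (t m) (s n) (t n)) ⟩
    ∣ (s m ℚ.- s n) ℚ.+ (t m ℚ.- t n) ∣
      ≤⟨ ℚₚ.∣p+q∣≤∣p∣+∣q∣ (s m ℚ.- s n) (t m ℚ.- t n) ⟩
    ∣ s m ℚ.- s n ∣ ℚ.+ ∣ t m ℚ.- t n ∣
      ≤⟨ ℚₚ.+-mono-≤ (hM m n (ℕₚ.m⊔n≤o⇒m≤o M N m≥) (ℕₚ.m⊔n≤o⇒m≤o M N n≥))
                     (hN m n (ℕₚ.m⊔n≤o⇒n≤o M N m≥) (ℕₚ.m⊔n≤o⇒n≤o M N n≥)) ⟩
    ½ ℚ.* ε ℚ.+ ½ ℚ.* ε
      ≡⟨ ½+½ ε ⟩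
    ε ∎
  where
  open ℚₚ.≤-Reasoning
  open +-*-Solver
  rearrange : ∀ a b c d → (a ℚ.+ b) ℚ.- (c ℚ.+ d) ≡ (a ℚ.- c) ℚ.+ (b ℚ.- d)
  rearrange = solve 4 (λ a b c d → (a :+ b) :- (c :+ d) := (a :- c) :+ (b :- d)) refl

neg-cauchy : ∀ {s} → Cauchy s → Cauchy (λ n → ℚ.- s n)
neg-cauchy {s} cs ε 0<ε =
  let N , hN = cs ε 0<ε
  in N , λ m n m≥ n≥ → subst (ℚ._≤ ε)
       (trans (sym (ℚₚ.∣-p∣≡∣p∣ (s m ℚ.- s n)))
              (cong ∣_∣ (ℚₚ.neg-distrib-+ (s m) (ℚ.- s n))))
       (hN m n m≥ n≥)

EventuallyBounded : (ℕ → ℚ) → ℚ → Set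
EventuallyBounded s B = (0ℚ ℚ.< B) × ∃[ N ] ∀ n → N ℕ.≤ n → ∣ s n ∣ ℚ.≤ B

cauchy⇒bounded : ∀ {s} → Cauchy s → ∃ (EventuallyBounded s)
cauchy⇒bounded {s} cs =
  let N , hN = cs 1ℚ 0<1
  in 1ℚ ℚ.+ ∣ s N ∣
  , ℚₚ.+-mono-<-≤ 0<1 (ℚₚ.0≤∣p∣ (s N))
  , N , λ n n≥ → begin
    ∣ s n ∣
      ≡⟨ cong ∣_∣ (split (s n) (s N)) ⟩
    ∣ (s n ℚ.- s N) ℚ.+ s N ∣
      ≤⟨ ℚₚ.∣p+q∣≤∣p∣+∣q∣ (s n ℚ.- s N) (s N) ⟩
    ∣ s n ℚ.- s N ∣ ℚ.+ ∣ s N ∣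
      ≤⟨ ℚₚ.+-monoˡ-≤ ∣ s N ∣ (hN n N n≥ ℕₚ.≤-refl) ⟩
    1ℚ ℚ.+ ∣ s N ∣ ∎
  where
  open ℚₚ.≤-Reasoning
  open +-*-Solver
  split : ∀ a b → a ≡ (a ℚ.- b) ℚ.+ b
  split = solve 2 (λ a b → a := (a :- b) :+ b) refl

*-cauchy : ∀ {s t} → Cauchy s → Cauchy t → Cauchy (λ n → s n ℚ.* t n)
*-cauchy {s} {t} cs ct ε 0<ε = go (cauchy⇒bounded {s} cs) (cauchy⇒bounded {t} ct)
  where
  open ℚₚ.≤-Reasoning
  open +-*-Solver
  rearrange : ∀ a b c d →
    a ℚ.* b ℚ.- c ℚ.* d ≡ a ℚ.* (b ℚ.- d) ℚ.+ (a ℚ.- c) ℚ.* d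
  rearrange = solve 4 (λ a b c d →
    a :* b :- c :* d := a :* (b :- d) :+ (a :- c) :* d) refl
  collect : ∀ a b e q →
    a ℚ.* (e ℚ.* q) ℚ.+ (e ℚ.* q) ℚ.* b ≡ e ℚ.* (q ℚ.* (a ℚ.+ b))
  collect = solve 4 (λ a b e q →
    a :* (e :* q) :+ (e :* q) :* b := e :* (q :* (a :+ b))) refl
  go : ∃ (EventuallyBounded s) → ∃ (EventuallyBounded t) →
    ∃[ N ] ∀ m n → N ℕ.≤ m → N ℕ.≤ n → ∣ s m ℚ.* t m ℚ.- s n ℚ.* t n ∣ ℚ.≤ ε
  go (A , 0<A , K , hK) (B , 0<B , L , hL) =
   let r      = recip (A ℚ.+ B) (0<+ 0<A 0<B)
       δ      = ε ℚ.* r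
       0<δ    = 0<* 0<ε (0<recip (A ℚ.+ B) (0<+ 0<A 0<B))
       M , hM = cs δ 0<δ
       N , hN = ct δ 0<δ
       k≤     = λ m (h : (K ℕ.⊔ L) ℕ.⊔ (M ℕ.⊔ N) ℕ.≤ m) → ℕₚ.m⊔n≤o⇒m≤o K L (ℕₚ.m⊔n≤o⇒m≤o (K ℕ.⊔ L) (M ℕ.⊔ N) h)
       l≤     = λ m (h : (K ℕ.⊔ L) ℕ.⊔ (M ℕ.⊔ N) ℕ.≤ m) → ℕₚ.m⊔n≤o⇒n≤o K L (ℕₚ.m⊔n≤o⇒m≤o (K ℕ.⊔ L) (M ℕ.⊔ N) h)
       m≤     = λ m (h : (K ℕ.⊔ L) ℕ.⊔ (M ℕ.⊔ N) ℕ.≤ m) → ℕₚ.m⊔n≤o⇒m≤o M N (ℕₚ.m⊔n≤o⇒n≤o (K ℕ.⊔ L) (M ℕ.⊔ N) h)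
       n≤     = λ m (h : (K ℕ.⊔ L) ℕ.⊔ (M ℕ.⊔ N) ℕ.≤ m) → ℕₚ.m⊔n≤o⇒n≤o M N (ℕₚ.m⊔n≤o⇒n≤o (K ℕ.⊔ L) (M ℕ.⊔ N) h)
   in (K ℕ.⊔ L) ℕ.⊔ (M ℕ.⊔ N) , λ m n m≥ n≥ → begin
    ∣ s m ℚ.* t m ℚ.- s n ℚ.* t n ∣
      ≡⟨ cong ∣_∣ (rearrange (s m) (t m) (s n) (t n)) ⟩
    ∣ s m ℚ.* (t m ℚ.- t n) ℚ.+ (s m ℚ.- s n) ℚ.* t n ∣
      ≤⟨ ℚₚ.∣p+q∣≤∣p∣+∣q∣ (s m ℚ.* (t m ℚ.- t n)) ((s m ℚ.- s n) ℚ.* t n) ⟩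
    ∣ s m ℚ.* (t m ℚ.- t n) ∣ ℚ.+ ∣ (s m ℚ.- s n) ℚ.* t n ∣
      ≡⟨ cong₂ ℚ._+_ (ℚₚ.∣p*q∣≡∣p∣*∣q∣ (s m) (t m ℚ.- t n))
                     (ℚₚ.∣p*q∣≡∣p∣*∣q∣ (s m ℚ.- s n) (t n)) ⟩
    ∣ s m ∣ ℚ.* ∣ t m ℚ.- t n ∣ ℚ.+ ∣ s m ℚ.- s n ∣ ℚ.* ∣ t n ∣
      ≤⟨ ℚₚ.+-mono-≤
           (*-mono-≤ (ℚₚ.0≤∣p∣ (s m)) (ℚₚ.<⇒≤ 0<δ)
              (hK m (k≤ m m≥)) (hN m n (n≤ m m≥) (n≤ n n≥)))
           (*-mono-≤ (ℚₚ.0≤∣p∣ (s m ℚ.- s n)) (ℚₚ.<⇒≤ 0<B)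
              (hM m n (m≤ m m≥) (m≤ n n≥)) (hL n (l≤ n n≥))) ⟩
    A ℚ.* δ ℚ.+ δ ℚ.* B
      ≡⟨ collect A B ε r ⟩
    ε ℚ.* (r ℚ.* (A ℚ.+ B))
      ≡⟨ cong (ε ℚ.*_) (recip-inverseˡ (A ℚ.+ B) (0<+ 0<A 0<B)) ⟩
    ε ℚ.* 1ℚ
      ≡⟨ ℚₚ.*-identityʳ ε ⟩
    ε ∎

infixl 6 _+_ _-_
infixl 7 _*_
infix  8 -_

_+_ : ℝ → ℝ → ℝ
x + y = mkℝ (λ n → seq x n ℚ.+ seq y n) (+-cauchy {seq x} {seq y} (cauchy x) (cauchy y))

-_ : ℝ → ℝ
- x = mkℝ (λ n → ℚ.- seq x n) (neg-cauchy {seq x} (cauchy x))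

_-_ : ℝ → ℝ → ℝ
x - y = x + (- y)

_*_ : ℝ → ℝ → ℝ
x * y = mkℝ (λ n → seq x n ℚ.* seq y n) (*-cauchy {seq x} {seq y} (cauchy x) (cauchy y))

0<⊔ : ∀ p {δ} → 0ℚ ℚ.< δ → 0ℚ ℚ.< p ℚ.⊔ δ
0<⊔ p {δ} 0<δ = ℚₚ.<-≤-trans 0<δ (ℚₚ.p≤q⊔p p δ)

recip-cauchy : ∀ {s δ} (0<δ : 0ℚ ℚ.< δ) N → (∀ n → N ℕ.≤ n → δ ℚ.≤ s n) →
  Cauchy s → Cauchy (λ n → recip (s n ℚ.⊔ δ) (0<⊔ (s n) 0<δ))
recip-cauchy {s} {δ} 0<δ N δ≤s cs ε 0<ε =
  let M , hM = cs (ε ℚ.* (δ ℚ.* δ)) (0<* 0<ε (0<* 0<δ 0<δ))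
  in N ℕ.⊔ M , λ m n m≥ n≥ → bound m n
    (ℚₚ.p≥q⇒p⊔q≡p (δ≤s m (ℕₚ.m⊔n≤o⇒m≤o N M m≥)))
    (ℚₚ.p≥q⇒p⊔q≡p (δ≤s n (ℕₚ.m⊔n≤o⇒m≤o N M n≥)))
    (hM n m (ℕₚ.m⊔n≤o⇒n≤o N M n≥) (ℕₚ.m⊔n≤o⇒n≤o N M m≥))
  where
  open ℚₚ.≤-Reasoning
  a u : ℕ → ℚ
  a n = s n ℚ.⊔ δ
  u n = recip (a n) (0<⊔ (s n) 0<δ)
  0<a : ∀ n → 0ℚ ℚ.< a n
  0<a n = 0<⊔ (s n) 0<δ
  u*a : ∀ n → u n ℚ.* a n ≡ 1ℚ
  u*a n = recip-inverseˡ (a n) (0<a n)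
  rearrange : ∀ p q x y → (p ℚ.- q) ℚ.* (x ℚ.* y) ≡ (p ℚ.* x) ℚ.* y ℚ.- (q ℚ.* y) ℚ.* x
  rearrange = solve 4 (λ p q x y →
    (p :- q) :* (x :* y) := (p :* x) :* y :- (q :* y) :* x) refl
    where open +-*-Solver
  difference : ∀ m n → (u m ℚ.- u n) ℚ.* (a m ℚ.* a n) ≡ a n ℚ.- a m
  difference m n = trans (rearrange (u m) (u n) (a m) (a n))
    (cong₂ ℚ._-_ (trans (cong (ℚ._* a n) (u*a m)) (ℚₚ.*-identityˡ (a n)))
                 (trans (cong (ℚ._* a m) (u*a n)) (ℚₚ.*-identityˡ (a m))))
  bound : ∀ m n → a m ≡ s m → a n ≡ s n →
    ∣ s n ℚ.- s m ∣ ℚ.≤ ε ℚ.* (δ ℚ.* δ) → ∣ u m ℚ.- u n ∣ ℚ.≤ ε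
  bound m n am an h =
    ℚₚ.*-cancelʳ-≤-pos (δ ℚ.* δ) {{ℚ.positive (0<* 0<δ 0<δ)}} (begin
    ∣ u m ℚ.- u n ∣ ℚ.* (δ ℚ.* δ)
      ≤⟨ ℚₚ.*-monoˡ-≤-nonNeg ∣ u m ℚ.- u n ∣ {{ℚ.nonNegative (ℚₚ.0≤∣p∣ (u m ℚ.- u n))}}
           (*-mono-≤ (ℚₚ.<⇒≤ 0<δ) (ℚₚ.<⇒≤ (0<a n))
                     (ℚₚ.p≤q⊔p (s m) δ) (ℚₚ.p≤q⊔p (s n) δ)) ⟩
    ∣ u m ℚ.- u n ∣ ℚ.* (a m ℚ.* a n)
      ≡⟨ cong (∣ u m ℚ.- u n ∣ ℚ.*_)
           (sym (ℚₚ.0≤p⇒∣p∣≡p (ℚₚ.<⇒≤ (0<* (0<a m) (0<a n))))) ⟩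
    ∣ u m ℚ.- u n ∣ ℚ.* ∣ a m ℚ.* a n ∣
      ≡⟨ sym (ℚₚ.∣p*q∣≡∣p∣*∣q∣ (u m ℚ.- u n) (a m ℚ.* a n)) ⟩
    ∣ (u m ℚ.- u n) ℚ.* (a m ℚ.* a n) ∣
      ≡⟨ cong ∣_∣ (trans (difference m n) (cong₂ ℚ._-_ an am)) ⟩
    ∣ s n ℚ.- s m ∣
      ≤⟨ h ⟩
    ε ℚ.* (δ ℚ.* δ) ∎)

eventually-≥ : ∀ x → ((δ , _) : 0ℝ < x) → ∃[ N ] ∀ n → N ℕ.≤ n → δ ℚ.≤ seq x n
eventually-≥ x (δ , _ , N , h) =
  N , λ n n≥ → subst (ℚ._≤ seq x n) (ℚₚ.+-identityˡ δ) (h n n≥)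

-- The terms of x are eventually at least δ, so truncating them below at δ
-- does not change the limit.
inv : (x : ℝ) → 0ℝ < x → ℝ
inv x 0<x@(δ , 0<δ , _) = mkℝ
  (λ n → recip (seq x n ℚ.⊔ δ) (0<⊔ (seq x n) 0<δ))
  (recip-cauchy {seq x} 0<δ (proj₁ (eventually-≥ x 0<x)) (proj₂ (eventually-≥ x 0<x)) (cauchy x))

recip-antimono : ∀ p q 0<p 0<q → p ℚ.≤ q → recip q 0<q ℚ.≤ recip p 0<p
recip-antimono p q 0<p 0<q p≤q = ℚₚ.*-cancelʳ-≤-pos p {{ℚ.positive 0<p}} (begin
    recip q 0<q ℚ.* p
      ≤⟨ ℚₚ.*-monoˡ-≤-nonNeg (recip q 0<q) {{ℚ.nonNegative (ℚₚ.<⇒≤ (0<recip q 0<q))}} p≤q ⟩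
    recip q 0<q ℚ.* q
      ≡⟨ trans (recip-inverseˡ q 0<q) (sym (recip-inverseˡ p 0<p)) ⟩
    recip p 0<p ℚ.* p ∎)
  where open ℚₚ.≤-Reasoning

0<inv : ∀ x 0<x → 0ℝ < inv x 0<x
0<inv x 0<x@(δ , 0<δ , _) =
  let B , 0<B , M , hM = cauchy⇒bounded {seq x} (cauchy x)
      N , hN = eventually-≥ x 0<x
  in recip B 0<B , 0<recip B 0<B , M ℕ.⊔ N , λ n n≥ →
  let δ≤x = hN n (ℕₚ.m⊔n≤o⇒n≤o M N n≥)
      x≤B = subst (ℚ._≤ B) (ℚₚ.0≤p⇒∣p∣≡p (ℚₚ.≤-trans (ℚₚ.<⇒≤ 0<δ) δ≤x))
                  (hM n (ℕₚ.m⊔n≤o⇒m≤o M N n≥))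
  in subst (ℚ._≤ seq (inv x 0<x) n) (sym (ℚₚ.+-identityˡ (recip B 0<B)))
       (recip-antimono (seq x n ℚ.⊔ δ) B (0<⊔ (seq x n) 0<δ) 0<B
          (ℚₚ.⊔-lub x≤B (ℚₚ.≤-trans δ≤x x≤B)))

0<ℝ* : ∀ x y → 0ℝ < x → 0ℝ < y → 0ℝ < x * y
0<ℝ* x y 0<x@(δ , 0<δ , _) 0<y@(ε , 0<ε , _) =
  let M , hM = eventually-≥ x 0<x
      N , hN = eventually-≥ y 0<y
  in δ ℚ.* ε , 0<* 0<δ 0<ε , M ℕ.⊔ N , λ n n≥ →
  let ε≤y = hN n (ℕₚ.m⊔n≤o⇒n≤o M N n≥)
  in subst (ℚ._≤ seq x n ℚ.* seq y n) (sym (ℚₚ.+-identityˡ (δ ℚ.* ε)))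
       (*-mono-≤ (ℚₚ.<⇒≤ 0<δ) (ℚₚ.≤-trans (ℚₚ.<⇒≤ 0<ε) ε≤y)
          (hM n (ℕₚ.m⊔n≤o⇒m≤o M N n≥)) ε≤y)

0<fromℕ : ∀ n .{{_ : ℕ.NonZero n}} → 0ℝ < fromℕ n
0<fromℕ n = + n ℚ./ 1 , ℚₚ.positive⁻¹ _ {{ℚₚ.normalize-pos n 1}} , 0 ,
  λ _ _ → ℚₚ.≤-reflexive (ℚₚ.+-identityˡ (+ n ℚ./ 1))

-- The interval (0, ∞].
data Dim : Set where
  fin : (n : ℝ) → 0ℝ < n → Dim
  ∞   : Dim

infix 4 _<ᵈ_
_<ᵈ_ : Dim → Dim → Set
fin m _ <ᵈ fin n _ = m < n
fin _ _ <ᵈ ∞       = ⊤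
∞       <ᵈ _       = ⊥

infixl 7 _÷_
_÷_ : ℝ → Dim → ℝ
a ÷ fin n 0<n = a * inv n 0<n
a ÷ ∞         = 0ℝ

-- p / q as an element of (0, ∞], for p > 0 and q ≥ 0, where p / 0 = ∞.
-- (The value ∞ is also returned for the irrelevant case q < 0.)
quotient : (p q : ℝ) → 0ℝ < p → Dec (0ℝ < q) → Dim
quotient p q 0<p (yes 0<q) = fin (p * inv q 0<q) (0<ℝ* p (inv q 0<q) 0<p (0<inv q 0<q))
quotient p q 0<p (no _)    = ∞

Enumerates : {A : Set} → List A → (A → Set) → Set
Enumerates xs P = Unique xs × (∀ z → z ∈ xs ⇔ P z)

HasExactly : {A : Set} → ℕ → (A → Set) → Set
HasExactly k P = ∃[ xs ] Enumerates xs P × length xs ≡ k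

record Graph : Set₁ where
  infix 4 _~_
  field
    V        : Set
    _~_      : V → V → Set
    ~-sym    : Symmetric _~_
    ~-irrefl : Irreflexive _≡_ _~_
    N        : V → List V
    N-enum   : ∀ x → Enumerates (N x) (x ~_)

module _ (G : Graph) where
  open Graph G

  -- A connected graph is nonempty.
  Connected : Set
  Connected = V × (∀ x y → Star _~_ x y)

  Regular : ℕ → Set
  Regular d = ∀ x → HasExactly d (x ~_)

  CommonNeighbours : ℕ → Set
  CommonNeighbours τ = ∀ x y → x ~ y → HasExactly τ (λ z → x ~ z × y ~ z)

  Σ[_] : List V → (V → ℝ) → ℝ
  Σ[ xs ] f = foldr _+_ 0ℝ (map f xs)

  Δ : (V → ℝ) → V → ℝ
  Δ f x = Σ[ N x ] (λ y → f y - f x)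

  Γ : ℕ → (V → ℝ) → (V → ℝ) → V → ℝ
  Γ zero    f g x = f x * g x
  Γ (suc k) f g x = fromℚ ½ * (Δ (Γ k f g) x - Γ k f (Δ g) x - Γ k g (Δ f) x)

  CD : ℝ → Dim → Set
  CD κ n = ∀ (f : V → ℝ) (x : V) →
    κ * Γ 1 f f x + (Δ f x * Δ f x) ÷ n ≤ Γ 2 f f x

-- Let r be the distance to x, capped at 2. Because every edge at x lies in exactly τ
-- triangles, the polarised form Γ₂(r, g)(x) depends on g only through Δg(x):
--   Γ₁(r, g)(x) = ½ Δg(x)   and   Γ₂(r, g)(x) = ¼ (4 + τ) Δg(x).
-- With q = 4 + τ − 2κ, applying CD(κ, ∞) to g − (Δg(x) / d) r completes the square and gives
-- Γ₂(g, g) ≥ κ Γ₁(g, g) + (q / 4d) (Δg)² at x, whereas r itself attains equality; so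
-- CD(κ, n) is equivalent to 4d / n ≤ q. Real operations act termwise on Cauchy sequences,
-- so the identities are proved for rational-valued functions, index by index.

module Submission where

open import Defs hiding (_+_; _-_; -_; _*_; _≤_; _<_)
open import Axiom.ExcludedMiddle using (ExcludedMiddle)
import Data.Integer as ℤ
import Data.Integer.Properties as ℤₚ
open import Data.List using (List; []; _∷_; [_]; length; map; filter; foldr)
open import Data.List.Membership.Propositional using (_∈_)
open import Data.List.Membership.Propositional.Properties using (∈-filter⁺; ∈-filter⁻)
open import Data.List.Membership.Propositional.Properties.WithK using (unique∧set⇒bag)
open import Data.List.Properties using (map-cong-local)
open import Data.List.Relation.Binary.BagAndSetEquality using (∼bag⇒↭)
open import Data.List.Relation.Binary.Permutation.Propositional using (↭⇒↭ₛ)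
open import Data.List.Relation.Binary.Permutation.Propositional.Properties using (map⁺)
import Data.List.Relation.Binary.Permutation.Setoid.Properties as Permutation
import Data.List.Relation.Unary.All as All
open import Data.List.Relation.Unary.AllPairs using ([]; _∷_)
open import Data.List.Relation.Unary.Any using (here)
open import Data.List.Relation.Unary.Unique.Propositional.Properties using (filter⁺)
open import Data.Nat as ℕ using (ℕ; zero; suc; NonZero)
import Data.Nat.Properties as ℕₚ
open import Data.Product using (∃-syntax; _×_; _,_; proj₂; swap)
open import Data.Rational as ℚ using (ℚ; 0ℚ; 1ℚ; ½)
import Data.Rational.Properties as ℚₚ
open import Data.Rational.Solver using (module +-*-Solver)
open import Data.Rational.Unnormalised as ℚᵘ using (mkℚᵘ; *≡*)
import Data.Rational.Unnormalised.Properties as ℚᵘₚ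
open import Data.Sum using (inj₁; inj₂)
open import Function using (_∘_)
open import Function.Bundles using (mk⇔; module Equivalence)
open import Level using (0ℓ)
open import Relation.Binary.PropositionalEquality
  using (_≡_; _≗_; refl; sym; trans; cong; cong₂; subst; subst₂; setoid; module ≡-Reasoning)
open import Relation.Nullary using (¬_; Dec; yes; no; contradiction)
open import Relation.Unary using (Decidable)

open Equivalence using (to; from)

-- Rational constants and the two scalar inequalities.

ι : ℕ → ℚ
ι n = ℤ.+ n ℚ./ 1

¼ : ℚ
¼ = ℤ.+ 1 ℚ./ 4

-- The comparison is made in unnormalised rationals, where no reduction by a gcd blocks computation
-- for a variable `n`.
ι-suc : ∀ n → ι (suc n) ≡ 1ℚ ℚ.+ ι n
ι-suc n = ℚₚ.toℚᵘ-injective (begin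
  ℚ.toℚᵘ (ι (suc n))           ≈⟨ ℚₚ.toℚᵘ-fromℚᵘ (mkℚᵘ (ℤ.+ suc n) 0) ⟩
  mkℚᵘ (ℤ.+ suc n) 0           ≈⟨ *≡* (cong (λ k → (ℤ.+ 1 ℤ.+ k) ℤ.* ℤ.+ 1) (sym (ℤₚ.*-identityʳ (ℤ.+ n)))) ⟩
  ℚᵘ.1ℚᵘ ℚᵘ.+ mkℚᵘ (ℤ.+ n) 0   ≈⟨ ℚᵘₚ.+-congʳ ℚᵘ.1ℚᵘ (ℚₚ.toℚᵘ-fromℚᵘ (mkℚᵘ (ℤ.+ n) 0)) ⟨
  ℚᵘ.1ℚᵘ ℚᵘ.+ ℚ.toℚᵘ (ι n)     ≈⟨ ℚₚ.toℚᵘ-homo-+ 1ℚ (ι n) ⟨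
  ℚ.toℚᵘ (1ℚ ℚ.+ ι n)          ∎)
  where open ℚᵘₚ.≃-Reasoning

module _ where
  open import Data.Rational using (_+_; _-_; -_; _*_; _≤_; _<_)
  open ℚₚ.≤-Reasoning
  open +-*-Solver

  0≤p*p : ∀ p → 0ℚ ≤ p * p
  0≤p*p p with ℚₚ.≤-total 0ℚ p
  ... | inj₁ 0≤p = ℚₚ.nonNegative⁻¹ _ {{ℚₚ.nonNeg*nonNeg⇒nonNeg p {{ℚ.nonNegative 0≤p}} p {{ℚ.nonNegative 0≤p}}}}
  ... | inj₂ p≤0 = ℚₚ.nonNegative⁻¹ _ {{ℚₚ.nonPos*nonPos⇒nonPos p {{ℚ.nonPositive p≤0}} p {{ℚ.nonPositive p≤0}}}}

  -- The hypothesis is CD(κ, n) for the radial function at its centre, with `i` standing for 1 / n: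
  -- there Δ = d, Γ₁ = d / 2 and Γ₂ = (4 + t) d / 4. Its tolerance carries the factor d / 4 that
  -- gets cancelled.
  radial-inequality : ∀ κ d t i ε → 0ℚ < d →
    κ * (½ * d) + d * d * i ≤ ¼ * (ι 4 + t) * d + ε * (¼ * d) →
    ι 4 * d * i ≤ ι 4 + t - ι 2 * κ + ε
  radial-inequality κ d t i ε 0<d h =
    ℚₚ.*-cancelʳ-≤-pos (¼ * d) {{ℚ.positive (0<* (ℚₚ.positive⁻¹ ¼) 0<d)}} (begin
    ι 4 * d * i * (¼ * d)
      ≡⟨ solve 3 (λ κ d i →
           con (ι 4) :* d :* i :* (con ¼ :* d) :=
           (κ :* (con ½ :* d) :+ d :* d :* i) :- κ :* (con ½ :* d)) refl κ d i ⟩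
    (κ * (½ * d) + d * d * i) - κ * (½ * d)
      ≤⟨ ℚₚ.+-monoˡ-≤ (- (κ * (½ * d))) h ⟩
    (¼ * (ι 4 + t) * d + ε * (¼ * d)) - κ * (½ * d)
      ≡⟨ solve 4 (λ κ d t ε →
           (con ¼ :* (con (ι 4) :+ t) :* d :+ ε :* (con ¼ :* d)) :- κ :* (con ½ :* d) :=
           (con (ι 4) :+ t :- con (ι 2) :* κ :+ ε) :* (con ¼ :* d)) refl κ d t ε ⟩
    (ι 4 + t - ι 2 * κ + ε) * (¼ * d) ∎)

  -- Here A, B, D stand for Γ₁(g), Γ₂(g), Δg at the centre; the first inequality is
  -- CD(κ, ∞) for g - (D / d) radial.
  completed-square-inequality : ∀ κ d t e i ε A B D → 0ℚ < e → e * d ≡ 1ℚ →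
    let c = - e * D
        s = ¼ * (ι 4 + t)
    in
    κ * (A + c * (½ * D + ½ * D) + c * c * (½ * d)) + 0ℚ ≤
      B + c * (s * D + s * D) + c * c * (s * d) + ε →
    ι 4 * d * i ≤ ι 4 + t - ι 2 * κ →
    κ * A + D * D * i ≤ B + ε
  completed-square-inequality κ d t e i ε A B D 0<e ed≡1 hcd hi = begin
    κ * A + D * D * i
      -- The factor `e * d` = 1 is inserted to expose `ι 4 * d * i`, the quantity bounded by `hi`.
      ≡⟨ cong (κ * A +_) (trans (sym (ℚₚ.*-identityʳ (D * D * i)))
           (cong (D * D * i *_) (sym ed≡1))) ⟩
    κ * A + D * D * i * (e * d)
      ≡⟨ cong (κ * A +_) (solve 4 (λ D i e d →
           D :* D :* i :* (e :* d) := con ¼ :* e :* (D :* D) :* (con (ι 4) :* d :* i)) refl D i e d) ⟩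
    κ * A + ¼ * e * (D * D) * (ι 4 * d * i)
      ≤⟨ ℚₚ.+-monoʳ-≤ (κ * A) (ℚₚ.*-monoˡ-≤-nonNeg (¼ * e * (D * D)) {{ℚ.nonNegative 0≤¼eDD}} hi) ⟩
    κ * A + ¼ * e * (D * D) * (ι 4 + t - ι 2 * κ)
      -- With c = -eD and ed = 1, the cross term -eD² and the square term eD² / 2 leave -eD² / 2
      -- beside `A`; multiplied by κ, this is exactly the contribution of -2κ.
      ≡⟨ solve 5 (λ κ A e D t →
           κ :* A :+ con ¼ :* e :* (D :* D) :* (con (ι 4) :+ t :- con (ι 2) :* κ) :=
           (κ :* (A :+ (:- e) :* D :* (con ½ :* D :+ con ½ :* D) :+ e :* (D :* D) :* con ½) :+ con 0ℚ)
           :+ con ¼ :* (con (ι 4) :+ t) :* (e :* (D :* D))) refl κ A e D t ⟩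
    (κ * (A + c * (½ * D + ½ * D) + e * (D * D) * ½) + 0ℚ) + s * (e * (D * D))
      ≡⟨ cong (λ a → (κ * (A + c * (½ * D + ½ * D) + a) + 0ℚ) + s * (e * (D * D))) (cc ½) ⟨
    (κ * (A + c * (½ * D + ½ * D) + c * c * (½ * d)) + 0ℚ) + s * (e * (D * D))
      ≤⟨ ℚₚ.+-monoˡ-≤ (s * (e * (D * D))) hcd ⟩
    (B + c * (s * D + s * D) + c * c * (s * d) + ε) + s * (e * (D * D))
      ≡⟨ cong (λ a → (B + c * (s * D + s * D) + a + ε) + s * (e * (D * D))) (cc s) ⟩
    (B + c * (s * D + s * D) + e * (D * D) * s + ε) + s * (e * (D * D))
      ≡⟨ solve 5 (λ B e D s ε →
           (B :+ (:- e) :* D :* (s :* D :+ s :* D) :+ e :* (D :* D) :* s :+ ε)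
           :+ s :* (e :* (D :* D)) := B :+ ε) refl B e D s ε ⟩
    B + ε ∎
    where
    c s : ℚ
    c = - e * D
    s = ¼ * (ι 4 + t)
    0≤¼eDD : 0ℚ ≤ ¼ * e * (D * D)
    0≤¼eDD = ℚₚ.nonNegative⁻¹ _ {{ℚₚ.nonNeg*nonNeg⇒nonNeg
      (¼ * e) {{ℚ.nonNegative (ℚₚ.<⇒≤ (0<* (ℚₚ.positive⁻¹ ¼) 0<e))}}
      (D * D) {{ℚ.nonNegative (0≤p*p D)}}}}
    cc : ∀ a → c * c * (a * d) ≡ e * (D * D) * a
    cc a = begin-equality
      c * c * (a * d)
        ≡⟨ solve 4 (λ e D a d →
             (:- e) :* D :* ((:- e) :* D) :* (a :* d) := e :* (D :* D) :* a :* (e :* d)) refl e D a d ⟩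
      e * (D * D) * a * (e * d)
        ≡⟨ trans (cong (e * (D * D) * a *_) ed≡1) (ℚₚ.*-identityʳ _) ⟩
      e * (D * D) * a ∎

-- Finite sums of rationals over lists, and indicators.

module _ where
  open import Data.Rational using (_+_; _-_; -_; _*_; _≤_; _<_)
  open ≡-Reasoning
  open +-*-Solver

  module _ {A : Set} where

    ∑ : List A → (A → ℚ) → ℚ
    ∑ xs f = foldr _+_ 0ℚ (map f xs)

    ∑-cong : ∀ xs {f g : A → ℚ} → (∀ {z} → z ∈ xs → f z ≡ g z) → ∑ xs f ≡ ∑ xs g
    ∑-cong xs f≡g = cong (foldr _+_ 0ℚ) (map-cong-local (All.tabulate f≡g))

    ∑-linear : ∀ xs (f g : A → ℚ) c → ∑ xs (λ z → f z + c * g z) ≡ ∑ xs f + c * ∑ xs g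
    ∑-linear []       f g c = sym (trans (ℚₚ.+-identityˡ _) (ℚₚ.*-zeroʳ c))
    ∑-linear (x ∷ xs) f g c = trans (cong ((f x + c * g x) +_) (∑-linear xs f g c))
      (solve 5 (λ a b c s t →
        (a :+ c :* b) :+ (s :+ c :* t) := (a :+ s) :+ c :* (b :+ t)) refl
        (f x) (g x) c (∑ xs f) (∑ xs g))

    ∑-zero : ∀ (xs : List A) → ∑ xs (λ _ → 0ℚ) ≡ 0ℚ
    ∑-zero []       = refl
    ∑-zero (_ ∷ xs) = trans (ℚₚ.+-identityˡ _) (∑-zero xs)

    ∑-+ : ∀ xs (f g : A → ℚ) → ∑ xs (λ z → f z + g z) ≡ ∑ xs f + ∑ xs g
    ∑-+ xs f g = begin
      ∑ xs (λ z → f z + g z)       ≡⟨ ∑-cong xs (λ {z} _ → cong (f z +_) (sym (ℚₚ.*-identityˡ (g z)))) ⟩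
      ∑ xs (λ z → f z + 1ℚ * g z)  ≡⟨ ∑-linear xs f g 1ℚ ⟩
      ∑ xs f + 1ℚ * ∑ xs g         ≡⟨ cong (∑ xs f +_) (ℚₚ.*-identityˡ _) ⟩
      ∑ xs f + ∑ xs g              ∎

    ∑-* : ∀ xs c (f : A → ℚ) → ∑ xs (λ z → c * f z) ≡ c * ∑ xs f
    ∑-* xs c f = begin
      ∑ xs (λ z → c * f z)            ≡⟨ ∑-cong xs (λ {z} _ → sym (ℚₚ.+-identityˡ (c * f z))) ⟩
      ∑ xs (λ z → 0ℚ + c * f z)       ≡⟨ ∑-linear xs (λ _ → 0ℚ) f c ⟩
      ∑ xs (λ _ → 0ℚ) + c * ∑ xs f    ≡⟨ cong (_+ c * ∑ xs f) (∑-zero xs) ⟩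
      0ℚ + c * ∑ xs f                 ≡⟨ ℚₚ.+-identityˡ _ ⟩
      c * ∑ xs f                      ∎

    ∑-1 : ∀ (xs : List A) → ∑ xs (λ _ → 1ℚ) ≡ ι (length xs)
    ∑-1 []       = refl
    ∑-1 (_ ∷ xs) = trans (cong (1ℚ +_) (∑-1 xs)) (sym (ι-suc (length xs)))

    -- Duplicate-free lists with the same members are permutations of each other, and addition is
    -- commutative. Sums over `N x` can thus be evaluated on the enumerations that the regularity
    -- hypotheses provide.
    ∑-enumerations : ∀ {P : A → Set} {xs ys} → Enumerates xs P → Enumerates ys P →
      ∀ f → ∑ xs f ≡ ∑ ys f
    ∑-enumerations (xs! , xs⇔P) (ys! , ys⇔P) f =
      Permutation.foldr-commMonoid (setoid ℚ) ℚₚ.+-0-isCommutativeMonoid (↭⇒↭ₛ (map⁺ f (∼bag⇒↭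
        (unique∧set⇒bag xs! ys! λ {z} →
          mk⇔ (from (ys⇔P z) ∘ to (xs⇔P z)) (from (xs⇔P z) ∘ to (ys⇔P z))))))

  ∑-swap : ∀ {A B : Set} (xs : List A) (ys : List B) (h : A → B → ℚ) →
    ∑ xs (λ y → ∑ ys (h y)) ≡ ∑ ys (λ z → ∑ xs (λ y → h y z))
  ∑-swap []       ys h = sym (∑-zero ys)
  ∑-swap (x ∷ xs) ys h = trans (cong (∑ ys (h x) +_) (∑-swap xs ys h))
    (sym (∑-+ ys (h x) (λ z → ∑ xs (λ y → h y z))))

  -≡-1* : ∀ p → - p ≡ - 1ℚ * p
  -≡-1* = solve 1 (λ p → :- p := con (- 1ℚ) :* p) refl

  -- Exchanging the two summations turns the total S into -S.
  ∑-antisym : ∀ {A : Set} (xs : List A) (h : A → A → ℚ) → (∀ y z → h y z ≡ - h z y) →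
    ∑ xs (λ y → ∑ xs (h y)) ≡ 0ℚ
  ∑-antisym xs h anti = begin
    S                ≡⟨ solve 1 (λ s → s := con ½ :* (s :+ s)) refl S ⟩
    ½ * (S + S)      ≡⟨ cong (λ t → ½ * (S + t)) S≡-S ⟩
    ½ * (S + - S)    ≡⟨ cong (½ *_) (ℚₚ.+-inverseʳ S) ⟩
    0ℚ               ∎
    where
    S : ℚ
    S = ∑ xs (λ y → ∑ xs (h y))
    S≡-S : S ≡ - S
    S≡-S = begin
      S
        ≡⟨ ∑-swap xs xs h ⟩
      ∑ xs (λ z → ∑ xs (λ y → h y z))
        ≡⟨ ∑-cong xs (λ {z} _ → trans
             (∑-cong xs (λ {y} _ → trans (anti y z) (-≡-1* (h z y))))
             (∑-* xs (- 1ℚ) (h z))) ⟩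
      ∑ xs (λ z → - 1ℚ * ∑ xs (h z))
        ≡⟨ ∑-* xs (- 1ℚ) (λ z → ∑ xs (h z)) ⟩
      - 1ℚ * S
        ≡⟨ -≡-1* S ⟨
      - S ∎

  𝟙 : {P : Set} → Dec P → ℚ
  𝟙 (yes _) = 1ℚ
  𝟙 (no  _) = 0ℚ

  𝟙-yes : {P : Set} (P? : Dec P) → P → 𝟙 P? ≡ 1ℚ
  𝟙-yes (yes _) _ = refl
  𝟙-yes (no ¬p) p = contradiction p ¬p

  𝟙-no : {P : Set} (P? : Dec P) → ¬ P → 𝟙 P? ≡ 0ℚ
  𝟙-no (yes p) ¬p = contradiction p ¬p
  𝟙-no (no _)  _  = refl

  𝟙-cong : {P Q : Set} (P? : Dec P) (Q? : Dec Q) → (P → Q) → (Q → P) → 𝟙 P? ≡ 𝟙 Q?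
  𝟙-cong (yes p) Q? P⇒Q _   = sym (𝟙-yes Q? (P⇒Q p))
  𝟙-cong (no ¬p) Q? _   Q⇒P = sym (𝟙-no Q? (¬p ∘ Q⇒P))

  ∑-filter : ∀ {A : Set} {R : A → Set} (R? : Decidable R) xs f →
    ∑ xs (λ z → 𝟙 (R? z) * f z) ≡ ∑ (filter R? xs) f
  ∑-filter R? []       f = refl
  ∑-filter R? (x ∷ xs) f with R? x
  ... | yes _ = cong₂ _+_ (ℚₚ.*-identityˡ (f x)) (∑-filter R? xs f)
  ... | no  _ = trans (cong₂ _+_ (ℚₚ.*-zeroˡ (f x)) (∑-filter R? xs f)) (ℚₚ.+-identityˡ _)

  -- Filtering `xs` by `R?` enumerates the conjunction of `P` and `R`, so any other enumeration of
  -- it has the same sum. Indicators thereby express sums over intersections of neighbourhoods.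
  ∑-restrict : ∀ {A : Set} {P R : A → Set} {xs ys} → Enumerates xs P → (R? : Decidable R) →
    Enumerates ys (λ z → P z × R z) → ∀ f → ∑ xs (λ z → 𝟙 (R? z) * f z) ≡ ∑ ys f
  ∑-restrict {xs = xs} (xs! , xs⇔P) R? ys-enum f = trans (∑-filter R? xs f)
    (∑-enumerations
      ( filter⁺ R? xs!
      , λ z → mk⇔
          (λ z∈ → let z∈xs , Rz = ∈-filter⁻ R? z∈ in to (xs⇔P z) z∈xs , Rz)
          (λ (Pz , Rz) → ∈-filter⁺ R? (from (xs⇔P z) Pz) Rz))
      ys-enum f)

  -- The operators Δ and Γ on rational-valued functions.

  module _ (G : Graph) where
    open Graph G

    Δℚ : (V → ℚ) → V → ℚ
    Δℚ f x = ∑ (N x) (λ y → f y - f x)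

    Γℚ : ℕ → (V → ℚ) → (V → ℚ) → V → ℚ
    Γℚ zero    f g x = f x * g x
    Γℚ (suc k) f g x = ½ * (Δℚ (Γℚ k f g) x - Γℚ k f (Δℚ g) x - Γℚ k g (Δℚ f) x)

    Δℚ-cong : ∀ {f f′} → f ≗ f′ → Δℚ f ≗ Δℚ f′
    Δℚ-cong f≗f′ x = ∑-cong (N x) λ {y} _ → cong₂ _-_ (f≗f′ y) (f≗f′ x)

    Γℚ-cong : ∀ k {f f′ g g′} → f ≗ f′ → g ≗ g′ → Γℚ k f g ≗ Γℚ k f′ g′
    Γℚ-cong zero    f≗f′ g≗g′ x = cong₂ _*_ (f≗f′ x) (g≗g′ x)
    Γℚ-cong (suc k) f≗f′ g≗g′ x = cong (½ *_) (cong₂ _-_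
      (cong₂ _-_ (Δℚ-cong (Γℚ-cong k f≗f′ g≗g′) x) (Γℚ-cong k f≗f′ (Δℚ-cong g≗g′) x))
      (Γℚ-cong k g≗g′ (Δℚ-cong f≗f′) x))

    Δℚ-linear : ∀ f g c x → Δℚ (λ v → f v + c * g v) x ≡ Δℚ f x + c * Δℚ g x
    Δℚ-linear f g c x = trans
      (∑-cong (N x) λ {y} _ →
        solve 5 (λ a b a′ b′ c →
          (a :+ c :* b) :- (a′ :+ c :* b′) := (a :- a′) :+ c :* (b :- b′)) refl
          (f y) (g y) (f x) (g x) c)
      (∑-linear (N x) (λ y → f y - f x) (λ y → g y - g x) c)

    Γℚ-comm : ∀ k f g x → Γℚ k f g x ≡ Γℚ k g f x
    Γℚ-comm zero    f g x = ℚₚ.*-comm (f x) (g x)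
    Γℚ-comm (suc k) f g x = trans
      (cong (λ t → ½ * (t - Γℚ k f (Δℚ g) x - Γℚ k g (Δℚ f) x)) (Δℚ-cong (Γℚ-comm k f g) x))
      (solve 4 (λ h a b c → h :* (a :- b :- c) := h :* (a :- c :- b)) refl
        ½ (Δℚ (Γℚ k g f) x) (Γℚ k f (Δℚ g) x) (Γℚ k g (Δℚ f) x))

    -- The two linearities are mutual: the left one at level k + 1 uses the right one at level k,
    -- for the term in which Δ of the first argument moves to the second slot; the right one follows
    -- from the left one at the same level by symmetry.
    Γℚ-linearˡ : ∀ k f g h c x → Γℚ k (λ v → f v + c * g v) h x ≡ Γℚ k f h x + c * Γℚ k g h x
    Γℚ-linearʳ : ∀ k f g h c x → Γℚ k h (λ v → f v + c * g v) x ≡ Γℚ k h f x + c * Γℚ k h g x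

    Γℚ-linearˡ zero    f g h c x =
      solve 4 (λ a b c d → (a :+ c :* b) :* d := a :* d :+ c :* (b :* d)) refl (f x) (g x) c (h x)
    Γℚ-linearˡ (suc k) f g h c x = trans
      (cong (½ *_) (cong₂ _-_ (cong₂ _-_
        (trans (Δℚ-cong (Γℚ-linearˡ k f g h c) x) (Δℚ-linear (Γℚ k f h) (Γℚ k g h) c x))
        (Γℚ-linearˡ k f g (Δℚ h) c x))
        (trans (Γℚ-cong k {h} (λ _ → refl) (Δℚ-linear f g c) x)
               (Γℚ-linearʳ k (Δℚ f) (Δℚ g) h c x))))
      (solve 8 (λ e a a′ b b′ d d′ c →
        e :* (a :+ c :* a′ :- (b :+ c :* b′) :- (d :+ c :* d′)) :=
        e :* (a :- b :- d) :+ c :* (e :* (a′ :- b′ :- d′))) refl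
        ½ (Δℚ (Γℚ k f h) x) (Δℚ (Γℚ k g h) x) (Γℚ k f (Δℚ h) x) (Γℚ k g (Δℚ h) x)
        (Γℚ k h (Δℚ f) x) (Γℚ k h (Δℚ g) x) c)

    Γℚ-linearʳ k f g h c x = trans (Γℚ-comm k h _ x) (trans (Γℚ-linearˡ k f g h c x)
      (cong₂ (λ a b → a + c * b) (Γℚ-comm k f h x) (Γℚ-comm k g h x)))

    Γℚ-square : ∀ k f g c x → let h = λ v → f v + c * g v in
      Γℚ k h h x ≡ Γℚ k f f x + c * (Γℚ k g f x + Γℚ k g f x) + c * c * Γℚ k g g x
    Γℚ-square k f g c x = trans (Γℚ-linearˡ k f g _ c x) (trans
      (cong₂ (λ a b → a + c * b)
        (trans (Γℚ-linearʳ k f g f c x) (cong (λ a → Γℚ k f f x + c * a) (Γℚ-comm k f g x)))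
        (Γℚ-linearʳ k f g g c x))
      (solve 4 (λ a b d c → a :+ c :* b :+ c :* (b :+ c :* d) := a :+ c :* (b :+ b) :+ c :* c :* d)
        refl (Γℚ k f f x) (Γℚ k g f x) (Γℚ k g g x) c))

    -- The carré du champ formula: each product of differences is the difference of the products
    -- `f g`, corrected by multiples of the differences of `f` and of `g`, and these sum to
    -- Laplacians.
    Γ₁-gradient : ∀ f g x → Γℚ 1 f g x ≡ ½ * ∑ (N x) (λ y → (f y - f x) * (g y - g x))
    Γ₁-gradient f g x = cong (½ *_) (sym (begin
      ∑ (N x) (λ y → (f y - f x) * (g y - g x))
        ≡⟨ ∑-cong (N x) (λ {y} _ →
             solve 4 (λ a a′ b b′ → (a :- a′) :* (b :- b′) :=
               ((a :* b :- a′ :* b′) :+ (:- a′) :* (b :- b′)) :+ (:- b′) :* (a :- a′)) refl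
               (f y) (f x) (g y) (g x)) ⟩
      ∑ (N x) (λ y → ((f y * g y - f x * g x) + - f x * (g y - g x)) + - g x * (f y - f x))
        ≡⟨ ∑-linear (N x) (λ y → (f y * g y - f x * g x) + - f x * (g y - g x))
             (λ y → f y - f x) (- g x) ⟩
      ∑ (N x) (λ y → (f y * g y - f x * g x) + - f x * (g y - g x)) + - g x * Δℚ f x
        ≡⟨ cong (_+ - g x * Δℚ f x)
             (∑-linear (N x) (λ y → f y * g y - f x * g x) (λ y → g y - g x) (- f x)) ⟩
      Δℚ (λ v → f v * g v) x + - f x * Δℚ g x + - g x * Δℚ f x
        ≡⟨ solve 5 (λ a b c d e →
             a :+ (:- b) :* c :+ (:- d) :* e := a :- b :* c :- d :* e) refl
             (Δℚ (λ v → f v * g v) x) (f x) (Δℚ g x) (g x) (Δℚ f x) ⟩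
      Δℚ (λ v → f v * g v) x - f x * Δℚ g x - g x * Δℚ f x ∎))

    -- The radial function and its curvature identities.

    module _ (em : ExcludedMiddle 0ℓ) {d τ : ℕ}
      (regular : Regular G d) (common : CommonNeighbours G τ) (x : V) where

      infix 4 _≟_ _~?_
      _≟_ : (y z : V) → Dec (y ≡ z)
      _ ≟ _ = em

      _~?_ : (y z : V) → Dec (y ~ z)
      _ ~? _ = em

      -- The distance to x, capped at 2.
      radial : V → ℚ
      radial z = ι 2 - ι 2 * 𝟙 (x ≟ z) - 𝟙 (x ~? z)

      radial-centre : radial x ≡ 0ℚ
      radial-centre = cong₂ (λ a b → ι 2 - ι 2 * a - b)
        (𝟙-yes (x ≟ x) refl) (𝟙-no (x ~? x) (~-irrefl refl))

      radial-near : ∀ {y} → x ~ y → radial y ≡ 1ℚ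
      radial-near {y} x~y = cong₂ (λ a b → ι 2 - ι 2 * a - b)
        (𝟙-no (x ≟ y) λ { refl → ~-irrefl refl x~y }) (𝟙-yes (x ~? y) x~y)

      ∑-degree : ∀ y → ∑ (N y) (λ _ → 1ℚ) ≡ ι d
      ∑-degree y = let ys , ys-enum , ∣ys∣≡d = regular y in
        trans (∑-enumerations (N-enum y) ys-enum (λ _ → 1ℚ)) (trans (∑-1 ys) (cong ι ∣ys∣≡d))

      ∑-codegree : ∀ {y} → x ~ y → ∑ (N x) (λ z → 𝟙 (y ~? z) * 1ℚ) ≡ ι τ
      ∑-codegree {y} x~y = let zs , zs-enum , ∣zs∣≡τ = common x y x~y in
        trans (∑-restrict (N-enum x) (y ~?_) zs-enum (λ _ → 1ℚ)) (trans (∑-1 zs) (cong ι ∣zs∣≡τ))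

      -- Since `radial y` is 1, the weight of a neighbour z of y is 1 - 2[z = x] - [z ~ x]. The last
      -- part is a sum over common neighbours, rewritten over `N x` so that summing over y later
      -- gives a double sum over one list.
      ∑-radial-near : ∀ {y} → x ~ y → ∀ φ →
        ∑ (N y) (λ z → (radial z - radial y) * φ z) ≡
        ∑ (N y) φ - ι 2 * φ x - ∑ (N x) (λ z → 𝟙 (y ~? z) * φ z)
      ∑-radial-near {y} x~y φ = begin
        ∑ (N y) (λ z → (radial z - radial y) * φ z)
          ≡⟨ ∑-cong (N y) (λ {z} _ → trans
               (cong (λ t → (radial z - t) * φ z) (radial-near x~y))
               (solve 3 (λ a b c →
                 (con (ι 2) :- con (ι 2) :* a :- b :- con 1ℚ) :* c :=
                 (c :+ con (- ι 2) :* (a :* c)) :+ con (- 1ℚ) :* (b :* c)) refl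
                 (𝟙 (x ≟ z)) (𝟙 (x ~? z)) (φ z))) ⟩
        ∑ (N y) (λ z → (φ z + - ι 2 * (𝟙 (x ≟ z) * φ z)) + - 1ℚ * (𝟙 (x ~? z) * φ z))
          ≡⟨ ∑-linear (N y) (λ z → φ z + - ι 2 * (𝟙 (x ≟ z) * φ z))
               (λ z → 𝟙 (x ~? z) * φ z) (- 1ℚ) ⟩
        ∑ (N y) (λ z → φ z + - ι 2 * (𝟙 (x ≟ z) * φ z)) + - 1ℚ * ∑ (N y) (λ z → 𝟙 (x ~? z) * φ z)
          ≡⟨ cong₂ (λ a b → a + - 1ℚ * b)
               (trans (∑-linear (N y) φ (λ z → 𝟙 (x ≟ z) * φ z) (- ι 2))
                      (cong (λ t → ∑ (N y) φ + - ι 2 * t) centre))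
               swap-neighbourhoods ⟩
        ∑ (N y) φ + - ι 2 * φ x + - 1ℚ * ∑ (N x) (λ z → 𝟙 (y ~? z) * φ z)
          ≡⟨ solve 3 (λ a b c →
               a :+ con (- ι 2) :* b :+ con (- 1ℚ) :* c := a :- con (ι 2) :* b :- c) refl
               (∑ (N y) φ) (φ x) (∑ (N x) (λ z → 𝟙 (y ~? z) * φ z)) ⟩
        ∑ (N y) φ - ι 2 * φ x - ∑ (N x) (λ z → 𝟙 (y ~? z) * φ z) ∎
        where
        centre : ∑ (N y) (λ z → 𝟙 (x ≟ z) * φ z) ≡ φ x
        centre = trans
          (∑-restrict {R = x ≡_} {ys = [ x ]} (N-enum y) (x ≟_)
            ( (All.[] ∷ [])
            , λ z → mk⇔ (λ { (here refl) → ~-sym x~y , refl }) (λ { (_ , refl) → here refl })) φ)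
          (ℚₚ.+-identityʳ (φ x))
        -- Both sides are the sum of φ over the common neighbours of x and y.
        swap-neighbourhoods :
          ∑ (N y) (λ z → 𝟙 (x ~? z) * φ z) ≡ ∑ (N x) (λ z → 𝟙 (y ~? z) * φ z)
        swap-neighbourhoods =
          let zs , (zs! , zs⇔) , _ = common x y x~y in trans
            (∑-restrict (N-enum y) (x ~?_)
              (zs! , λ z → mk⇔ (swap ∘ to (zs⇔ z)) (from (zs⇔ z) ∘ swap)) φ)
            (sym (∑-restrict (N-enum x) (y ~?_) (zs! , zs⇔) φ))

      ∑-radial-centre : ∀ (φ : V → ℚ) → ∑ (N x) (λ y → (radial y - radial x) * φ y) ≡ ∑ (N x) φ
      ∑-radial-centre φ = ∑-cong (N x) λ {y} y∈Nx → trans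
        (cong₂ (λ a b → (a - b) * φ y) (radial-near (to (proj₂ (N-enum x) y) y∈Nx)) radial-centre)
        (ℚₚ.*-identityˡ (φ y))

      Δ-radial-centre : Δℚ radial x ≡ ι d
      Δ-radial-centre = trans
        (∑-cong (N x) λ {y} _ → sym (ℚₚ.*-identityʳ (radial y - radial x)))
        (trans (∑-radial-centre (λ _ → 1ℚ)) (∑-degree x))

      -- Among the d neighbours of y, x contributes -1, the τ common neighbours 0, and the remaining
      -- d - 1 - τ contribute 1 each.
      Δ-radial-near : ∀ {y} → x ~ y → Δℚ radial y ≡ ι d - ι 2 - ι τ
      Δ-radial-near {y} x~y = trans
        (∑-cong (N y) λ {z} _ → sym (ℚₚ.*-identityʳ (radial z - radial y)))
        (trans (∑-radial-near x~y (λ _ → 1ℚ))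
          (cong₂ (λ a b → a - ι 2 - b) (∑-degree y) (∑-codegree x~y)))

      Γ₁-radial : ∀ g → Γℚ 1 radial g x ≡ ½ * Δℚ g x
      Γ₁-radial g = trans (Γ₁-gradient radial g x) (cong (½ *_) (∑-radial-centre (λ y → g y - g x)))

      -- `Δℚ radial` drops by the same amount 2 + τ from x to each of its neighbours, so the
      -- gradient sum is a multiple of Δg(x).
      Γ₁-Δ-radial : ∀ g → Γℚ 1 g (Δℚ radial) x ≡ ½ * ((- ι 2 - ι τ) * Δℚ g x)
      Γ₁-Δ-radial g = trans (Γ₁-gradient g (Δℚ radial) x) (cong (½ *_) (trans
        (∑-cong (N x) λ {y} y∈Nx → trans
          (cong₂ (λ a b → (g y - g x) * (a - b))
            (Δ-radial-near (to (proj₂ (N-enum x) y) y∈Nx)) Δ-radial-centre)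
          (solve 3 (λ a d t → a :* (d :- con (ι 2) :- t :- d) := (:- con (ι 2) :- t) :* a) refl
            (g y - g x) (ι d) (ι τ)))
        (∑-* (N x) (- ι 2 - ι τ) (λ y → g y - g x))))

      -- Adjacency is symmetric, so the summand changes sign when y and z are exchanged: edges
      -- inside the neighbourhood of x cancel.
      ∑∑-triangles : ∀ (g : V → ℚ) → ∑ (N x) (λ y → ∑ (N x) (λ z → 𝟙 (y ~? z) * (g z - g y))) ≡ 0ℚ
      ∑∑-triangles g = ∑-antisym (N x) (λ y z → 𝟙 (y ~? z) * (g z - g y)) λ y z → trans
        (cong (_* (g z - g y)) (𝟙-cong (y ~? z) (z ~? y) ~-sym ~-sym))
        (solve 3 (λ a b c → a :* (b :- c) := :- (a :* (c :- b))) refl (𝟙 (z ~? y)) (g z) (g y))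

      -- At a neighbour y, Γ₁(r, g)(y) equals (Δg(y) + 2(g(y) - g(x)) - S(y)) / 2, where S(y) runs
      -- over the triangles on the edge xy. Summed over y, the S(y) vanish.
      Δ-Γ₁-radial : ∀ g → Δℚ (Γℚ 1 radial g) x ≡ ½ * Δℚ (Δℚ g) x + Δℚ g x
      Δ-Γ₁-radial g = begin
        ∑ (N x) (λ y → Γℚ 1 radial g y - Γℚ 1 radial g x)
          ≡⟨ ∑-cong (N x) (λ {y} y∈Nx → trans
               (cong₂ _-_
                 (trans (Γ₁-gradient radial g y)
                   (cong (½ *_) (∑-radial-near (to (proj₂ (N-enum x) y) y∈Nx) (λ z → g z - g y))))
                 (Γ₁-radial g))
               (solve 5 (λ a b c e s →
                 con ½ :* (a :- con (ι 2) :* (b :- c) :- s) :- con ½ :* e :=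
                 ((c :- b) :+ con ½ :* (a :- e)) :+ con (- ½) :* s) refl
                 (Δℚ g y) (g x) (g y) (Δℚ g x) (S y))) ⟩
        ∑ (N x) (λ y → ((g y - g x) + ½ * (Δℚ g y - Δℚ g x)) + - ½ * S y)
          ≡⟨ ∑-linear (N x) (λ y → (g y - g x) + ½ * (Δℚ g y - Δℚ g x)) S (- ½) ⟩
        ∑ (N x) (λ y → (g y - g x) + ½ * (Δℚ g y - Δℚ g x)) + - ½ * ∑ (N x) S
          ≡⟨ cong₂ (λ a b → a + - ½ * b)
               (∑-linear (N x) (λ y → g y - g x) (λ y → Δℚ g y - Δℚ g x) ½)
               (∑∑-triangles g) ⟩
        Δℚ g x + ½ * Δℚ (Δℚ g) x + - ½ * 0ℚ
          ≡⟨ solve 2 (λ a b → a :+ b :+ con (- ½) :* con 0ℚ := b :+ a) refl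
               (Δℚ g x) (½ * Δℚ (Δℚ g) x) ⟩
        ½ * Δℚ (Δℚ g) x + Δℚ g x ∎
        where
        S : V → ℚ
        S y = ∑ (N x) (λ z → 𝟙 (y ~? z) * (g z - g y))

      -- The iterated Laplacian in ΔΓ₁(r, g) cancels against Γ₁(r, Δg), and only multiples of Δg(x)
      -- survive.
      Γ₂-radial : ∀ g → Γℚ 2 radial g x ≡ ¼ * (ι 4 + ι τ) * Δℚ g x
      Γ₂-radial g = trans
        (cong (½ *_) (cong₂ _-_ (cong₂ _-_ (Δ-Γ₁-radial g) (Γ₁-radial (Δℚ g))) (Γ₁-Δ-radial g)))
        (solve 3 (λ a b t →
          con ½ :* ((con ½ :* a :+ b) :- con ½ :* a :- con ½ :* ((:- con (ι 2) :- t) :* b)) :=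
          con ¼ :* (con (ι 4) :+ t) :* b) refl
          (Δℚ (Δℚ g) x) (Δℚ g x) (ι τ))

      Γ₁-shift : ∀ g c → let h = λ v → g v + c * radial v in
        Γℚ 1 h h x ≡ Γℚ 1 g g x + c * (½ * Δℚ g x + ½ * Δℚ g x) + c * c * (½ * ι d)
      Γ₁-shift g c = trans (Γℚ-square 1 g radial c x)
        (cong₂ (λ a b → Γℚ 1 g g x + c * (a + a) + c * c * b)
          (Γ₁-radial g)
          (trans (Γ₁-radial radial)
            (cong (½ *_) Δ-radial-centre)))

      Γ₂-shift : ∀ g c → let h = λ v → g v + c * radial v
                             s = ¼ * (ι 4 + ι τ) in
        Γℚ 2 h h x ≡ Γℚ 2 g g x + c * (s * Δℚ g x + s * Δℚ g x) + c * c * (s * ι d)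
      Γ₂-shift g c = trans (Γℚ-square 2 g radial c x)
        (cong₂ (λ a b → Γℚ 2 g g x + c * (a + a) + c * c * b)
          (Γ₂-radial g)
          (trans (Γ₂-radial radial)
            (cong (¼ * (ι 4 + ι τ) *_) Δ-radial-centre)))

      -- The coefficient `c` comes with an equation because it will be a term of the sequence of a
      -- real Laplacian, which equals the rational Laplacian only propositionally.
      completed-square : ∀ κ e i ε c g → 0ℚ < e → e * ι d ≡ 1ℚ → c ≡ - e * Δℚ g x →
        let h = λ v → g v + c * radial v in
        κ * Γℚ 1 h h x + 0ℚ ≤ Γℚ 2 h h x + ε →
        ι 4 * ι d * i ≤ ι 4 + ι τ - ι 2 * κ →
        κ * Γℚ 1 g g x + Δℚ g x * Δℚ g x * i ≤ Γℚ 2 g g x + ε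
      completed-square κ e i ε _ g 0<e ed≡1 refl hcd =
        completed-square-inequality κ (ι d) (ι τ) e i ε (Γℚ 1 g g x) (Γℚ 2 g g x) (Δℚ g x)
          0<e ed≡1 (subst₂ (λ a b → κ * a + 0ℚ ≤ b + ε) (Γ₁-shift g c) (Γ₂-shift g c) hcd)
        where
        c : ℚ
        c = - e * Δℚ g x

-- Eventual properties of sequences, and inverses of reals.

Eventually : (ℕ → Set) → Set
Eventually P = ∃[ n₀ ] ∀ n → n₀ ℕ.≤ n → P n

eventually-map : ∀ {P Q : ℕ → Set} → (∀ n → P n → Q n) → Eventually P → Eventually Q
eventually-map P⇒Q (n₀ , h) = n₀ , λ n n≥ → P⇒Q n (h n n≥)

infixr 4 _⊗_
_⊗_ : ∀ {P Q : ℕ → Set} → Eventually P → Eventually Q → Eventually (λ n → P n × Q n)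
(m , h) ⊗ (n , k) = m ℕ.⊔ n , λ i i≥ →
  h i (ℕₚ.m⊔n≤o⇒m≤o m n i≥) , k i (ℕₚ.m⊔n≤o⇒n≤o m n i≥)

eventually-const : ∀ {P : Set} → Eventually (λ _ → P) → P
eventually-const (n₀ , h) = h n₀ ℕₚ.≤-refl

open Defs using (_+_; _-_; _*_; _≤_; _<_)

-- `inv` truncates at δ from below, so the product is 1 once the terms have reached δ.
inv-inverseˡ : ∀ x 0<x → Eventually (λ n → seq (inv x 0<x) n ℚ.* seq x n ≡ 1ℚ)
inv-inverseˡ x 0<x@(δ , 0<δ , _) = eventually-map
  (λ n δ≤x → trans
    (cong (seq (inv x 0<x) n ℚ.*_) (sym (ℚₚ.p≥q⇒p⊔q≡p δ≤x)))
    (recip-inverseˡ (seq x n ℚ.⊔ δ) (0<⊔ (seq x n) 0<δ)))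
  (eventually-≥ x 0<x)

-- For p = 4d and q the gap, this is p / n = q at n = p / q. It is exact from some index on, so it
-- costs no tolerance.
inv-quotient : ∀ p q 0<q 0<pq⁻¹ →
  Eventually (λ n → seq p n ℚ.* seq (inv (p * inv q 0<q) 0<pq⁻¹) n ≡ seq q n)
inv-quotient p q 0<q 0<pq⁻¹ = eventually-map
  (λ n (jpi≡1 , iq≡1) → arithmetic (seq p n) (seq q n) (seq (inv q 0<q) n) _ jpi≡1 iq≡1)
  (inv-inverseˡ (p * inv q 0<q) 0<pq⁻¹ ⊗ inv-inverseˡ q 0<q)
  where
  open ≡-Reasoning
  open +-*-Solver
  arithmetic : ∀ p q i j → j ℚ.* (p ℚ.* i) ≡ 1ℚ → i ℚ.* q ≡ 1ℚ → p ℚ.* j ≡ q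
  arithmetic p q i j jpi≡1 iq≡1 = begin
    p ℚ.* j                    ≡⟨ ℚₚ.*-identityʳ (p ℚ.* j) ⟨
    p ℚ.* j ℚ.* 1ℚ             ≡⟨ cong (p ℚ.* j ℚ.*_) iq≡1 ⟨
    p ℚ.* j ℚ.* (i ℚ.* q)      ≡⟨ solve 4 (λ p q i j → p :* j :* (i :* q) := j :* (p :* i) :* q) refl p q i j ⟩
    j ℚ.* (p ℚ.* i) ℚ.* q      ≡⟨ cong (ℚ._* q) jpi≡1 ⟩
    1ℚ ℚ.* q                   ≡⟨ ℚₚ.*-identityˡ q ⟩
    q                          ∎

-- A positive lower bound for p / m passes to q. This will exclude finite dimensions when the gap is
-- not positive.
pos*inv≤⇒pos : ∀ p q m 0<m → 0ℝ < p → p * inv m 0<m ≤ q → 0ℝ < q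
pos*inv≤⇒pos p q m 0<m 0<p p/m≤q =
  let ε , 0<ε , ev = 0<ℝ* p (inv m 0<m) 0<p (0<inv m 0<m)
      -- Half of the lower bound ε is spent as tolerance; the other half remains below q.
      0<½ε = 0<* (ℚₚ.positive⁻¹ ½) 0<ε
  in ½ ℚ.* ε , 0<½ε , eventually-map
    (λ n (ε≤p/m , p/m≤q+½ε) → arithmetic ε (seq q n) (ℚₚ.≤-trans ε≤p/m p/m≤q+½ε))
    (ev ⊗ p/m≤q (½ ℚ.* ε) 0<½ε)
  where
  open ℚₚ.≤-Reasoning
  open +-*-Solver
  arithmetic : ∀ ε q → 0ℚ ℚ.+ ε ℚ.≤ q ℚ.+ ½ ℚ.* ε → 0ℚ ℚ.+ ½ ℚ.* ε ℚ.≤ q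
  arithmetic ε q h = begin
    0ℚ ℚ.+ ½ ℚ.* ε                     ≡⟨ solve 1 (λ ε → con 0ℚ :+ con ½ :* ε := con 0ℚ :+ ε :- con ½ :* ε) refl ε ⟩
    0ℚ ℚ.+ ε ℚ.- ½ ℚ.* ε               ≤⟨ ℚₚ.+-monoˡ-≤ (ℚ.- (½ ℚ.* ε)) h ⟩
    q ℚ.+ ½ ℚ.* ε ℚ.- ½ ℚ.* ε          ≡⟨ solve 2 (λ q a → q :+ a :- a := q) refl q (½ ℚ.* ε) ⟩
    q                                  ∎

-- A margin η in m < p / q would give ηδ ≤ εB for every tolerance ε, where δ bounds q from below and
-- B bounds m from above.
<*inv⇒≰ : ∀ p q m 0<q 0<m → m < p * inv q 0<q → ¬ (p * inv m 0<m ≤ q)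
<*inv⇒≰ p q m 0<q@(δ , 0<δ , _) 0<m@(μ , 0<μ , _) (η , 0<η , m<p/q) p/m≤q =
  let B , 0<B , m≤B = cauchy⇒bounded {seq m} (cauchy m)
      ηδ   = η ℚ.* δ
      0<ηδ = 0<* 0<η 0<δ
      0<B⁻¹ = 0<recip B 0<B
      -- Chosen so that εB is half of ηδ.
      ε    = ½ ℚ.* ηδ ℚ.* recip B 0<B
      0<ε  = 0<* (0<* (ℚₚ.positive⁻¹ ½) 0<ηδ) 0<B⁻¹
  in ℚₚ.<-irrefl refl (ℚₚ.<-≤-trans (½<1 ηδ 0<ηδ) (eventually-const (eventually-map
    (λ n (mη≤pj , pi≤q+ε , jq≡1 , im≡1 , δ≤q , μ≤m , ∣m∣≤B) →
      ℚₚ.≤-trans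
        (arithmetic (seq p n) (seq q n) (seq m n) _ _ η ε δ B
          (ℚₚ.<⇒≤ 0<η) (ℚₚ.<⇒≤ 0<δ) (ℚₚ.<⇒≤ 0<ε)
          mη≤pj pi≤q+ε jq≡1 im≡1 δ≤q (ℚₚ.≤-trans (ℚₚ.<⇒≤ 0<μ) μ≤m)
          (subst (ℚ._≤ B) (ℚₚ.0≤p⇒∣p∣≡p (ℚₚ.≤-trans (ℚₚ.<⇒≤ 0<μ) μ≤m)) ∣m∣≤B))
        (ℚₚ.≤-reflexive (trans (ℚₚ.*-assoc (½ ℚ.* ηδ) (recip B 0<B) B)
          (trans (cong (½ ℚ.* ηδ ℚ.*_) (recip-inverseˡ B 0<B)) (ℚₚ.*-identityʳ (½ ℚ.* ηδ))))))
    (m<p/q ⊗ p/m≤q ε 0<ε ⊗ inv-inverseˡ q 0<q ⊗ inv-inverseˡ m 0<m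
      ⊗ eventually-≥ q 0<q ⊗ eventually-≥ m 0<m ⊗ m≤B))))
  where
  open ℚₚ.≤-Reasoning
  open +-*-Solver
  ½<1 : ∀ a → 0ℚ ℚ.< a → ½ ℚ.* a ℚ.< a
  ½<1 a 0<a = begin-strict
    ½ ℚ.* a                ≡⟨ ℚₚ.+-identityʳ (½ ℚ.* a) ⟨
    ½ ℚ.* a ℚ.+ 0ℚ         <⟨ ℚₚ.+-monoʳ-< (½ ℚ.* a) (0<* (ℚₚ.positive⁻¹ ½) 0<a) ⟩
    ½ ℚ.* a ℚ.+ ½ ℚ.* a    ≡⟨ ½+½ a ⟩
    a                      ∎
  -- Multiplying the two hypotheses by q and m gives (m + η) q ≤ p ≤ (q + ε) m.
  arithmetic : ∀ p q m i j η ε δ B → 0ℚ ℚ.≤ η → 0ℚ ℚ.≤ δ → 0ℚ ℚ.≤ ε →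
    m ℚ.+ η ℚ.≤ p ℚ.* j → p ℚ.* i ℚ.≤ q ℚ.+ ε → j ℚ.* q ≡ 1ℚ → i ℚ.* m ≡ 1ℚ →
    δ ℚ.≤ q → 0ℚ ℚ.≤ m → m ℚ.≤ B → η ℚ.* δ ℚ.≤ ε ℚ.* B
  arithmetic p q m i j η ε δ B 0≤η 0≤δ 0≤ε mη≤pj pi≤qε jq≡1 im≡1 δ≤q 0≤m m≤B = begin
    η ℚ.* δ
      ≤⟨ ℚₚ.*-monoˡ-≤-nonNeg η {{ℚ.nonNegative 0≤η}} δ≤q ⟩
    η ℚ.* q
      ≡⟨ solve 3 (λ η q m → η :* q := (m :+ η) :* q :- m :* q) refl η q m ⟩
    (m ℚ.+ η) ℚ.* q ℚ.- m ℚ.* q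
      ≤⟨ ℚₚ.+-monoˡ-≤ (ℚ.- (m ℚ.* q)) (ℚₚ.*-monoʳ-≤-nonNeg q {{ℚ.nonNegative (ℚₚ.≤-trans 0≤δ δ≤q)}} mη≤pj) ⟩
    p ℚ.* j ℚ.* q ℚ.- m ℚ.* q
      ≡⟨ cong (ℚ._- m ℚ.* q) (trans (ℚₚ.*-assoc p j q) (trans
           (cong (p ℚ.*_) (trans jq≡1 (sym im≡1))) (sym (ℚₚ.*-assoc p i m)))) ⟩
    p ℚ.* i ℚ.* m ℚ.- m ℚ.* q
      ≤⟨ ℚₚ.+-monoˡ-≤ (ℚ.- (m ℚ.* q)) (ℚₚ.*-monoʳ-≤-nonNeg m {{ℚ.nonNegative 0≤m}} pi≤qε) ⟩
    (q ℚ.+ ε) ℚ.* m ℚ.- m ℚ.* q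
      ≡⟨ solve 3 (λ q ε m → (q :+ ε) :* m :- m :* q := ε :* m) refl q ε m ⟩
    ε ℚ.* m
      ≤⟨ ℚₚ.*-monoˡ-≤-nonNeg ε {{ℚ.nonNegative 0≤ε}} m≤B ⟩
    ε ℚ.* B ∎

-- With 1 / ∞ = 0, finite and infinite dimensions obey one and the same inequality.
1/ᵈ_ : Dim → ℝ
1/ᵈ fin n 0<n = inv n 0<n
1/ᵈ ∞         = 0ℝ

seq-÷ : ∀ a D n → seq (a ÷ D) n ≡ seq a n ℚ.* seq (1/ᵈ D) n
seq-÷ a (fin _ _) n = refl
seq-÷ a ∞         n = sym (ℚₚ.*-zeroʳ (seq a n))

-- Passage from real-valued functions to rational-valued ones.

module _ (G : Graph) where
  open Graph G

  _at_ : (V → ℝ) → ℕ → V → ℚ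
  (f at n) v = seq (f v) n

  seq-Σ : ∀ xs f n → seq (Σ[_] G xs f) n ≡ ∑ xs (f at n)
  seq-Σ []       f n = refl
  seq-Σ (x ∷ xs) f n = cong (seq (f x) n ℚ.+_) (seq-Σ xs f n)

  seq-Δ : ∀ f n → Δ G f at n ≗ Δℚ G (f at n)
  seq-Δ f n x = seq-Σ (N x) (λ y → f y - f x) n

  seq-Γ : ∀ k f g n → Γ G k f g at n ≗ Γℚ G k (f at n) (g at n)
  seq-Γ zero    f g n x = refl
  seq-Γ (suc k) f g n x = cong (½ ℚ.*_) (cong₂ ℚ._-_ (cong₂ ℚ._-_
    (trans (seq-Δ (Γ G k f g) n x) (Δℚ-cong G (seq-Γ k f g n) x))
    (trans (seq-Γ k f (Δ G g) n x) (Γℚ-cong G k (λ _ → refl) (seq-Δ g n) x)))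
    (trans (seq-Γ k g (Δ G f) n x) (Γℚ-cong G k (λ _ → refl) (seq-Δ f n) x)))

-- Curvature-dimension bounds and the gap 4 + τ - 2κ.

module _ (em : ExcludedMiddle 0ℓ) (G : Graph) (κ : ℝ) (d τ : ℕ) .{{_ : NonZero d}}
  (regular : Regular G d) (common : CommonNeighbours G τ) where
  open Graph G

  gap : ℝ
  gap = fromℕ 4 + fromℕ τ - fromℕ 2 * κ

  private
    0<d : 0ℚ ℚ.< ι d
    0<d = ℚₚ.positive⁻¹ _ {{ℚₚ.normalize-pos d 1}}

    R : V → V → ℚ
    R = radial G em regular common

  -- The radial function is tested at its centre, where both sides are known exactly.
  CD⇒≤gap : V → ∀ D → CD G κ D → fromℕ 4 * fromℕ d * 1/ᵈ D ≤ gap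
  CD⇒≤gap x D cd ε 0<ε = eventually-map
    (λ n h → radial-inequality (seq κ n) (ι d) (ι τ) (seq (1/ᵈ D) n) ε 0<d (subst₂ ℚ._≤_
      (cong₂ (λ a b → seq κ n ℚ.* a ℚ.+ b)
        (trans (seq-Γ G 1 r r n x) (trans (Γ₁-radial G em regular common x (R x))
          (cong (½ ℚ.*_) (Δ-radial-centre G em regular common x))))
        (trans (seq-÷ (Δ G r x * Δ G r x) D n)
          (cong (λ a → a ℚ.* a ℚ.* seq (1/ᵈ D) n)
            (trans (seq-Δ G r n x) (Δ-radial-centre G em regular common x)))))
      (cong (ℚ._+ ε ℚ.* (¼ ℚ.* ι d))
        (trans (seq-Γ G 2 r r n x) (trans (Γ₂-radial G em regular common x (R x))
          (cong (¼ ℚ.* (ι 4 ℚ.+ ι τ) ℚ.*_) (Δ-radial-centre G em regular common x)))))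
      h))
    (cd r x (ε ℚ.* (¼ ℚ.* ι d)) (0<* 0<ε (0<* (ℚₚ.positive⁻¹ ¼) 0<d)))
    where
    r : V → ℝ
    r z = fromℚ (R x z)

  -- The bound on `1/ᵈ D` is assumed termwise and without tolerance, which leaves all of ε to CD(κ,
  -- ∞) for `h`.
  ≤gap⇒CD : ∀ D → CD G κ ∞ →
    Eventually (λ n → ι 4 ℚ.* ι d ℚ.* seq (1/ᵈ D) n ℚ.≤ seq gap n) → CD G κ D
  ≤gap⇒CD D cd D≤gap g x ε 0<ε = eventually-map (λ n (cdₙ , D≤gapₙ) → transfer n
      (completed-square G em regular common x (seq κ n) e (seq (1/ᵈ D) n) ε (c n) (_at_ G g n)
        (0<recip (ι d) 0<d) (recip-inverseˡ (ι d) 0<d) (cong (ℚ.- e ℚ.*_) (seq-Δ G g n x))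
        (subst₂ (λ a b → seq κ n ℚ.* a ℚ.+ 0ℚ ℚ.≤ b ℚ.+ ε)
          (seq-Γ G 1 h h n x) (seq-Γ G 2 h h n x) cdₙ)
        D≤gapₙ))
    (cd h x ε 0<ε ⊗ D≤gap)
    where
    e : ℚ
    e = recip (ι d) 0<d
    c : ℕ → ℚ
    c n = ℚ.- e ℚ.* seq (Δ G g x) n
    h : V → ℝ
    -- One real-valued function serves all indices: the coefficient of the radial function is the
    -- real number -Δg(x) / d, whose n-th term is `c n`.
    h v = g v + fromℚ (ℚ.- e) * Δ G g x * fromℚ (R x v)
    transfer : ∀ n → let f = _at_ G g n in
      seq κ n ℚ.* Γℚ G 1 f f x ℚ.+ Δℚ G f x ℚ.* Δℚ G f x ℚ.* seq (1/ᵈ D) n ℚ.≤ Γℚ G 2 f f x ℚ.+ ε →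
      seq (κ * Γ G 1 g g x + (Δ G g x * Δ G g x) ÷ D) n ℚ.≤ seq (Γ G 2 g g x) n ℚ.+ ε
    transfer n = subst₂ ℚ._≤_
      (cong₂ (λ a b → seq κ n ℚ.* a ℚ.+ b) (sym (seq-Γ G 1 g g n x))
        (sym (trans (seq-÷ (Δ G g x * Δ G g x) D n)
          (cong (λ a → a ℚ.* a ℚ.* seq (1/ᵈ D) n) (seq-Δ G g n x)))))
      (cong (ℚ._+ ε) (sym (seq-Γ G 2 g g n x)))

  -- At D = ∞ the left side of `CD⇒≤gap` vanishes, so the gap is nonnegative.
  2κ≤4+τ : V → CD G κ ∞ → fromℕ 2 * κ ≤ fromℕ 4 + fromℕ τ
  2κ≤4+τ x cd ε 0<ε = eventually-map
    (λ n → arithmetic (ι 4 ℚ.* ι d) (ι 4 ℚ.+ ι τ) (ι 2 ℚ.* seq κ n))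
    (CD⇒≤gap x ∞ cd ε 0<ε)
    where
    open ℚₚ.≤-Reasoning
    open +-*-Solver
    arithmetic : ∀ p s t → p ℚ.* 0ℚ ℚ.≤ s ℚ.- t ℚ.+ ε → t ℚ.≤ s ℚ.+ ε
    arithmetic p s t h = begin
      t                        ≡⟨ solve 2 (λ p t → t := p :* con 0ℚ :+ t) refl p t ⟩
      p ℚ.* 0ℚ ℚ.+ t           ≤⟨ ℚₚ.+-monoˡ-≤ t h ⟩
      s ℚ.- t ℚ.+ ε ℚ.+ t      ≡⟨ solve 3 (λ s t ε → s :- t :+ ε :+ t := s :+ ε) refl s t ε ⟩
      s ℚ.+ ε                  ∎

  module _ (0<4d : 0ℝ < fromℕ 4 * fromℕ d) where

    CD-quotient : CD G κ ∞ → ∀ 0<gap? → CD G κ (quotient (fromℕ 4 * fromℕ d) gap 0<4d 0<gap?)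
    CD-quotient cd (yes 0<gap) = ≤gap⇒CD (quotient (fromℕ 4 * fromℕ d) gap 0<4d (yes 0<gap)) cd
      (eventually-map (λ n → ℚₚ.≤-reflexive) (inv-quotient (fromℕ 4 * fromℕ d) gap 0<gap
        (0<ℝ* (fromℕ 4 * fromℕ d) (inv gap 0<gap) 0<4d (0<inv gap 0<gap))))
    -- The quotient is ∞ here, so the hypothesis is the conclusion.
    CD-quotient cd (no _)      = cd

    -- Only finite D = m occur, as ∞ lies below nothing. From 4d / m ≤ gap, a positive gap
    -- contradicts m < 4d / gap; otherwise the gap is forced to be positive after all.
    CD-optimal : V → ∀ 0<gap? D → D <ᵈ quotient (fromℕ 4 * fromℕ d) gap 0<4d 0<gap? → ¬ CD G κ D
    CD-optimal x (yes 0<gap) (fin m 0<m) m< cd =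
      <*inv⇒≰ (fromℕ 4 * fromℕ d) gap m 0<gap 0<m m< (CD⇒≤gap x (fin m 0<m) cd)
    CD-optimal x (no 0≮gap)  (fin m 0<m) _  cd =
      0≮gap (pos*inv≤⇒pos (fromℕ 4 * fromℕ d) gap m 0<m 0<4d (CD⇒≤gap x (fin m 0<m) cd))

theorem2 : (em : ExcludedMiddle 0ℓ) →
    (G : Graph) → Connected G →
    (κ : ℝ) (d τ : ℕ) .{{_ : NonZero d}} →
    CD G κ ∞ → Regular G d → CommonNeighbours G τ →
    let q = fromℕ 4 + fromℕ τ - fromℕ 2 * κ
        n = quotient (fromℕ 4 * fromℕ d) q (0<ℝ* (fromℕ 4) (fromℕ d) (0<fromℕ 4) (0<fromℕ d)) em
    in (fromℕ 2 * κ ≤ fromℕ 4 + fromℕ τ)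
       × CD G κ n
       × ((n′ : Dim) → n′ <ᵈ n → ¬ CD G κ n′)
theorem2 em G (x , _) κ d τ cd regular common =
    2κ≤4+τ em G κ d τ regular common x cd
  , CD-quotient em G κ d τ regular common 0<4d cd em
  , CD-optimal em G κ d τ regular common 0<4d x em
  where
  0<4d : 0ℝ < fromℕ 4 * fromℕ d
  0<4d = 0<ℝ* (fromℕ 4) (fromℕ d) (0<fromℕ 4) (0<fromℕ d)
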